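{- Let $X$ be a finite set with $|X|\ge 3$, let $M$ be a set, and let $\delta:\binom X3\to M$ be any map (a three-way symbolic map on $X$). Then there exist a split system $\mathcal S$ on $X$ and a labelling map $l: V-\{\phi_x: x\in X\}\to M$, where $V$ is the vertex set of the Buneman graph $\mathcal B(\mathcal S)$, such that $\delta(Y)=l(\phi_Y)$ for all $Y\in\binom X3$, where $\phi_Y$ is the median in $\mathcal B(\mathcal S)$ of the three leaves $\phi_x$, $x\in Y$.
   Context: Let $X$ be a finite set with $|X|\ge 3$; $\binom X3$ is the set of 3-element subsets of $X$. A split of $X$ is an unordered bipartition $A|B=B|A$ of $X$ into two non-empty disjoint subsets (its parts) with $A\cup B=X$. It is trivial if one of its parts has size 1. A split system on $X$ is a set $\mathcal S$ of splits of $X$ that contains all trivial splits $\{x\}|X-\{x\}$, $x\in X$. For $S\in\mathcal S$ and $x\in X$, $S(x)$ denotes the part of $S$ containing $x$. The Buneman graph $\mathcal B(\mathcal S)$ has as vertices all maps $\phi:\mathcal S\to\mathcal P(X)$ such that (B1) $\phi(S)\in S$ for all $S\in\mathcal S$, and (B2) $\phi(S)\cap\phi(S')\ne\emptyset$ for all distinct $S,S'\in\mathcal S$. Two vertices $\phi,\phi'$ are adjacent if there is a unique $S\in\mathcal S$ with $\phi(S)\neq\phi'(S)$. For $x\in X$, $\phi_x$ denotes the vertex $S\mapsto S(x)$, which is a leaf (degree-one vertex) of $\mathcal B(\mathcal S)$; the leaf set is identified with $X$. It is known that $\mathcal B(\mathcal S)$ is a median graph, i.e. it is connected and any three vertices $u,v,w$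 have a unique median (a vertex lying on shortest paths between each pair of $u,v,w$). -}

module Defs where

open import Level using (0ℓ; _⊔_)
open import Data.Bool.Base using (if_then_else_)
open import Data.Empty using (⊥-elim)
open import Data.Nat.Base using (ℕ; zero; suc; _≤_)
open import Data.Fin.Base using (Fin)
open import Data.Fin.Subset using (Subset; _∈_; _∩_; _∪_; ⊤; ∣_∣; Nonempty; Empty)
open import Data.Fin.Subset.Properties using (_∈?_; ∈⊤; x∈p∩q⁺; x∈p∪q⁻)
open import Data.Product using (Σ; ∃; ∃!; _×_; _,_; proj₁; proj₂)
open import Data.Sum.Base using (_⊎_; inj₁; inj₂)
open import Relation.Nullary using (¬_; yes; no; does)
open import Relation.Unary using (Pred)
open import Relation.Binary.Core using (Rel)
open import Relation.Binary.Bundles using (Setoid)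
open import Relation.Binary.Definitions using (_Respects_)
open import Relation.Binary.PropositionalEquality
  using (_≡_; _≢_; refl; sym; trans; subst; setoid)
open import Function.Bundles using (Func)

-- Throughout, the finite set X is Fin n.

Triple : ℕ → Set
Triple n = Σ (Subset n) (λ Y → ∣ Y ∣ ≡ 3)

record Split (n : ℕ) : Set where
  field
    A B       : Subset n
    nonemptyA : Nonempty A
    nonemptyB : Nonempty B
    disjoint  : Empty (A ∩ B)
    cover     : A ∪ B ≡ ⊤

-- Splits are unordered: A|B and B|A are the same split.
_≈ˢ_ : ∀ {n} → Rel (Split n) 0ℓ
S ≈ˢ T = (S.A ≡ T.A × S.B ≡ T.B) ⊎ (S.A ≡ T.B × S.B ≡ T.A)
  where
  module S = Split S
  module T = Split T

IsPart : ∀ {n} → Subset n → Split n → Set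
IsPart P S = P ≡ Split.A S ⊎ P ≡ Split.B S

Trivial : ∀ {n} → Split n → Set
Trivial S = ∣ Split.A S ∣ ≡ 1 ⊎ ∣ Split.B S ∣ ≡ 1

part : ∀ {n} → Split n → Fin n → Subset n
part S x = if does (x ∈? Split.A S) then Split.A S else Split.B S

part-isPart : ∀ {n} (S : Split n) x → IsPart (part S x) S
part-isPart S x with x ∈? Split.A S
... | yes _ = inj₁ refl
... | no  _ = inj₂ refl

x∈part : ∀ {n} (S : Split n) x → x ∈ part S x
x∈part S x with x ∈? Split.A S
... | yes x∈A = x∈A
... | no  x∉A with x∈p∪q⁻ (Split.A S) (Split.B S) (subst (x ∈_) (sym (Split.cover S)) ∈⊤)
...   | inj₁ x∈A = ⊥-elim (x∉A x∈A)
...   | inj₂ x∈B = x∈B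

part-unique : ∀ {n} (S : Split n) x {P} → IsPart P S → x ∈ P → P ≡ part S x
part-unique S x p x∈P with x ∈? Split.A S
part-unique S x (inj₁ refl) x∈P | yes _   = refl
part-unique S x (inj₂ refl) x∈P | yes x∈A = ⊥-elim (Split.disjoint S (x , x∈p∩q⁺ (x∈A , x∈P)))
part-unique S x (inj₁ refl) x∈P | no  x∉A = ⊥-elim (x∉A x∈P)
part-unique S x (inj₂ refl) x∈P | no  _   = refl

IsPart-resp : ∀ {n} {S T : Split n} {P} → S ≈ˢ T → IsPart P S → IsPart P T
IsPart-resp (inj₁ (a , b)) (inj₁ p) = inj₁ (trans p a)
IsPart-resp (inj₁ (a , b)) (inj₂ p) = inj₂ (trans p b)
IsPart-resp (inj₂ (a , b)) (inj₁ p) = inj₂ (trans p a)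
IsPart-resp (inj₂ (a , b)) (inj₂ p) = inj₁ (trans p b)

part-cong : ∀ {n} {S T : Split n} (x : Fin n) → S ≈ˢ T → part S x ≡ part T x
part-cong {S = S} {T} x S≈T =
  part-unique T x (IsPart-resp {S = S} {T} S≈T (part-isPart S x)) (x∈part S x)

record SplitSystem (n : ℕ) : Set₁ where
  field
    member  : Pred (Split n) 0ℓ
    resp    : member Respects _≈ˢ_
    trivial : ∀ S → Trivial S → member S

-- Graphs whose vertices are taken up to the equivalence _≈_.
module Graph {a ℓ₁ ℓ₂} {V : Set a} (_≈_ : Rel V ℓ₁) (_~_ : Rel V ℓ₂) where

  data Walk : V → V → ℕ → Set (a ⊔ ℓ₁ ⊔ ℓ₂) where
    stop : ∀ {u v} → u ≈ v → Walk u v zero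
    step : ∀ {u w v k} → u ~ w → Walk w v k → Walk u v (suc k)

  data _On_ (m : V) : ∀ {u v k} → Walk u v k → Set (a ⊔ ℓ₁ ⊔ ℓ₂) where
    end   : ∀ {u v} {e : u ≈ v} → m ≈ v → m On stop e
    here  : ∀ {u w v k} {e : u ~ w} {p : Walk w v k} → m ≈ u → m On step e p
    there : ∀ {u w v k} {e : u ~ w} {p : Walk w v k} → m On p → m On step e p

  -- A walk of minimal length repeats no vertex, so it is a shortest path.
  IsShortest : ∀ {u v k} → Walk u v k → Set (a ⊔ ℓ₁ ⊔ ℓ₂)
  IsShortest {u} {v} {k} _ = ∀ {j} → Walk u v j → k ≤ j

  OnShortestPath : V → V → V → Set (a ⊔ ℓ₁ ⊔ ℓ₂)
  OnShortestPath u v m = ∃ λ k → Σ (Walk u v k) λ p → IsShortest p × m On p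

  IsMedian : V → V → V → V → Set (a ⊔ ℓ₁ ⊔ ℓ₂)
  IsMedian u v w m = OnShortestPath u v m × OnShortestPath v w m × OnShortestPath u w m

module Buneman {n : ℕ} (𝒮 : SplitSystem n) where

  Member : Set
  Member = ∃ (SplitSystem.member 𝒮)

  _≈ᵐ_ : Rel Member 0ℓ
  S ≈ᵐ T = proj₁ S ≈ˢ proj₁ T

  -- `φ-cong` makes φ a map on unordered splits, independent of the
  -- proof of membership in 𝒮.
  record Vertex : Set where
    field
      φ      : Member → Subset n
      φ-cong : ∀ {S T} → S ≈ᵐ T → φ S ≡ φ T
      B1     : ∀ S → IsPart (φ S) (proj₁ S)
      B2     : ∀ S T → ¬ (S ≈ᵐ T) → Nonempty (φ S ∩ φ T)

  open Vertex public

  _≈ᵛ_ : Rel Vertex 0ℓ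
  u ≈ᵛ v = ∀ S → φ u S ≡ φ v S

  Adjacent : Rel Vertex 0ℓ
  Adjacent u v = ∃! _≈ᵐ_ (λ S → φ u S ≢ φ v S)

  open Graph _≈ᵛ_ Adjacent public

  leaf : Fin n → Vertex
  leaf x = record
    { φ      = λ (S , _) → part S x
    ; φ-cong = λ {S} {T} → part-cong {S = proj₁ S} {proj₁ T} x
    ; B1     = λ (S , _) → part-isPart S x
    ; B2     = λ (S , _) (T , _) _ → x , x∈p∩q⁺ (x∈part S x , x∈part T x)
    }

  Interior : Set
  Interior = Σ Vertex (λ v → ∀ x → ¬ (v ≈ᵛ leaf x))

  interiorSetoid : Setoid 0ℓ 0ℓ
  interiorSetoid = record
    { Carrier       = Interior
    ; _≈_           = λ u v → proj₁ u ≈ᵛ proj₁ v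
    ; isEquivalence = record
      { refl  = λ S → refl
      ; sym   = λ p S → sym (p S)
      ; trans = λ p q S → trans (p S) (q S)
      }
    }

  Labelling : ∀ {ℓ} → Set ℓ → Set ℓ
  Labelling M = Func interiorSetoid (setoid M)

  IsMedianOfTriple : Triple n → Vertex → Set
  IsMedianOfTriple (Y , _) m =
    ∀ x y z → x ∈ Y → y ∈ Y → z ∈ Y → x ≢ y → y ≢ z → x ≢ z →
    IsMedian (leaf x) (leaf y) (leaf z) m

{-# OPTIONS --safe #-}
-- Take for 𝒮 the system of all splits of X. The distance in the Buneman graph is the
-- number of splits on which two vertices differ: if u and v differ, a split S on which
-- they differ and for which u(S) is smallest can be flipped from u(S) to v(S) without
-- leaving the graph. Hence m lies on a shortest path from u to v iff m(S) ∈ {u(S), v(S)}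
-- for all S, and the median of three leaves is given by majority vote. The median
-- determines the triple Y: if x ∈ Y and x ∉ Y', choose a ∈ Y different from x; on the split
-- {x,a} | X - {x,a} the majorities of Y and of Y' lie on different sides. So δ factors
-- through the median.
module Submission where

open import Defs
open import Level using (Level; 0ℓ)
open import Data.Bool.Base using (if_then_else_)
import Data.Bool.Properties as Bool
open import Data.Nat.Base using (ℕ; zero; suc; _+_; _≤_; z≤n; s≤s)
open import Data.Nat.ListAction using (sum)
import Data.Nat.Properties as ℕ
open import Data.Nat.Solver using (module +-*-Solver)
open import Data.Fin.Base using (Fin; zero; suc)
import Data.Fin.Properties as Fin
open import Data.Fin.Subset as Subset using (Subset; _∈_; _∉_; _⊆_; _∩_; _∪_; _-_; ∁; ⁅_⁆; ∣_∣; Nonempty; inside; outside)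
open import Data.Fin.Subset.Properties
open import Data.List.Base using (List; []; _∷_; map; filter; concatMap; cartesianProductWith; deduplicate)
open import Data.List.Extrema ℕ.≤-totalOrder using (argmin; argmin-all; f[argmin]≤f[xs])
open import Data.List.Membership.Propositional using (find) renaming (_∈_ to _∈ₗ_)
open import Data.List.Membership.Propositional.Properties using (∈-filter⁺; ∈-cartesianProductWith⁺)
open import Data.List.Relation.Unary.All as All using (All; []; _∷_)
open import Data.List.Relation.Unary.All.Properties using (all-filter; ¬Any⇒All¬)
open import Data.List.Relation.Unary.AllPairs using (AllPairs; []; _∷_)
open import Data.List.Relation.Unary.Any as Any using (Any; here; there; any?)
open import Data.List.Relation.Unary.Any.Properties using (concatMap⁺)
open import Data.List.Relation.Unary.Enumerates.Setoid using (IsEnumeration)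
open import Data.List.Relation.Unary.Enumerates.Setoid.Properties using (deduplicate⁺)
open import Data.List.Relation.Unary.Unique.DecSetoid.Properties using (deduplicate-!)
open import Data.Product.Base using (Σ; ∃; _×_; _,_; proj₁; proj₂)
open import Data.Sum.Base using (_⊎_; inj₁; inj₂; [_,_]′; swap)
open import Data.Vec.Base using ([]; _∷_; here; there)
open import Data.Vec.Properties using (≡-dec)
open import Function.Bundles using (Func)
open import Relation.Binary.Bundles using (DecSetoid)
open import Relation.Binary.Definitions using (DecidableEquality)
open import Relation.Binary.PropositionalEquality using (_≡_; _≢_; refl; sym; trans; cong; cong₂; subst; module ≡-Reasoning)
open import Relation.Nullary using (¬_; Dec; yes; no; does; ¬?; contradiction)
open import Relation.Nullary.Decidable using (_×-dec_; _⊎-dec_; decidable-stable; map′)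
open import Relation.Unary using (U)

_≟ˢ_ : ∀ {n} → DecidableEquality (Subset n)
_≟ˢ_ = ≡-dec Bool._≟_

-- Finite sums

module _ {a} {A : Set a} where

  sum-mono : ∀ {f g : A → ℕ} → (∀ x → f x ≤ g x) → ∀ xs → sum (map f xs) ≤ sum (map g xs)
  sum-mono f≤g []       = z≤n
  sum-mono f≤g (x ∷ xs) = ℕ.+-mono-≤ (f≤g x) (sum-mono f≤g xs)

  sum-cong : ∀ {f g : A → ℕ} → (∀ x → f x ≡ g x) → ∀ xs → sum (map f xs) ≡ sum (map g xs)
  sum-cong f≡g []       = refl
  sum-cong f≡g (x ∷ xs) = cong₂ _+_ (f≡g x) (sum-cong f≡g xs)

  sum-+ : ∀ (f g : A → ℕ) xs →
          sum (map (λ x → f x + g x) xs) ≡ sum (map f xs) + sum (map g xs)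
  sum-+ f g []       = refl
  sum-+ f g (x ∷ xs) = trans (cong (f x + g x +_) (sum-+ f g xs)) (interchange (f x) (g x) _ _)
    where
    open +-*-Solver
    interchange : ∀ a b c d → (a + b) + (c + d) ≡ (a + c) + (b + d)
    interchange = solve 4 (λ a b c d → (a :+ b) :+ (c :+ d) := (a :+ c) :+ (b :+ d)) refl

  sum-zero : ∀ {f : A → ℕ} {xs} → All (λ x → f x ≡ 0) xs → sum (map f xs) ≡ 0
  sum-zero []       = refl
  sum-zero (p ∷ ps) = cong₂ _+_ p (sum-zero ps)

  -- No term of `g` lies below the matching term of `f`, so a strict gap at one entry could not be
  -- made up at another.
  sum-tight : ∀ {f g : A → ℕ} → (∀ x → f x ≤ g x) → ∀ {xs} →
              sum (map g xs) ≤ sum (map f xs) → All (λ x → g x ≤ f x) xs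
  sum-tight f≤g {[]} _ = []
  sum-tight {f} {g} f≤g {x ∷ xs} le =
    ℕ.+-cancelʳ-≤ _ _ _ (ℕ.≤-trans le (ℕ.+-monoʳ-≤ (f x) (sum-mono f≤g xs)))
    ∷ sum-tight f≤g (ℕ.+-cancelˡ-≤ _ _ _ (ℕ.≤-trans le (ℕ.+-monoˡ-≤ _ (f≤g x))))

-- Splits of a finite set

module _ {n : ℕ} where

  splitOf : (A : Subset n) → Nonempty A → Nonempty (∁ A) → Split n
  splitOf A neA ne∁A = record
    { A = A ; B = ∁ A ; nonemptyA = neA ; nonemptyB = ne∁A
    ; disjoint = λ (x , x∈) → let x∈A , x∈∁A = x∈p∩q⁻ A (∁ A) x∈ in x∈p⇒x∉∁p x∈A x∈∁A
    ; cover = p∪∁p≡⊤ A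
    }

  module _ (S : Split n) where
    open Split S

    ∉A⇒∈B : ∀ {x} → x ∉ A → x ∈ B
    ∉A⇒∈B {x} x∉A with x∈p∪q⁻ A B (subst (x ∈_) (sym cover) ∈⊤)
    ... | inj₁ x∈A = contradiction x∈A x∉A
    ... | inj₂ x∈B = x∈B

    ∈A⇒∉B : ∀ {x} → x ∈ A → x ∉ B
    ∈A⇒∉B x∈A x∈B = disjoint (_ , x∈p∩q⁺ (x∈A , x∈B))

    A≢B : A ≢ B
    A≢B A≡B = let x , x∈A = nonemptyA in ∈A⇒∉B x∈A (subst (x ∈_) A≡B x∈A)

    B≡∁A : B ≡ ∁ A
    B≡∁A = ⊆-antisym (λ x∈B → x∉p⇒x∈∁p (λ x∈A → ∈A⇒∉B x∈A x∈B)) (λ x∈∁A → ∉A⇒∈B (x∈∁p⇒x∉p x∈∁A))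

    A≡∁B : A ≡ ∁ B
    A≡∁B = ⊆-antisym (λ x∈A → x∉p⇒x∈∁p (∈A⇒∉B x∈A))
      (λ x∈∁B → decidable-stable (_ ∈? A) (λ x∉A → x∈∁p⇒x∉p x∈∁B (∉A⇒∈B x∉A)))

    third-part : ∀ {P Q R} → IsPart P S → IsPart Q S → IsPart R S → P ≢ Q → R ≡ P ⊎ R ≡ Q
    third-part (inj₁ p) (inj₁ q) _        P≢Q = contradiction (trans p (sym q)) P≢Q
    third-part (inj₂ p) (inj₂ q) _        P≢Q = contradiction (trans p (sym q)) P≢Q
    third-part (inj₁ p) (inj₂ q) (inj₁ r) _   = inj₁ (trans r (sym p))
    third-part (inj₁ p) (inj₂ q) (inj₂ r) _   = inj₂ (trans r (sym q))
    third-part (inj₂ p) (inj₁ q) (inj₁ r) _   = inj₂ (trans r (sym q))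
    third-part (inj₂ p) (inj₁ q) (inj₂ r) _   = inj₁ (trans r (sym p))

  -- The second part is the complement of the first, so one part determines the unordered split.
  shared-part : ∀ {S T : Split n} {P} → IsPart P S → IsPart P T → S ≈ˢ T
  shared-part {S} {T} (inj₁ p) (inj₁ q) = let e = trans (sym p) q in
    inj₁ (e , trans (B≡∁A S) (trans (cong ∁ e) (sym (B≡∁A T))))
  shared-part {S} {T} (inj₁ p) (inj₂ q) = let e = trans (sym p) q in
    inj₂ (e , trans (B≡∁A S) (trans (cong ∁ e) (sym (A≡∁B T))))
  shared-part {S} {T} (inj₂ p) (inj₁ q) = let e = trans (sym p) q in
    inj₂ (trans (A≡∁B S) (trans (cong ∁ e) (sym (B≡∁A T))) , e)
  shared-part {S} {T} (inj₂ p) (inj₂ q) = let e = trans (sym p) q in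
    inj₁ (trans (A≡∁B S) (trans (cong ∁ e) (sym (A≡∁B T))) , e)

  ≈ˢ-refl : ∀ {S : Split n} → S ≈ˢ S
  ≈ˢ-refl = inj₁ (refl , refl)

  ≈ˢ-sym : ∀ {S T : Split n} → S ≈ˢ T → T ≈ˢ S
  ≈ˢ-sym (inj₁ (a , b)) = inj₁ (sym a , sym b)
  ≈ˢ-sym (inj₂ (a , b)) = inj₂ (sym b , sym a)

  ≈ˢ-trans : ∀ {R S T : Split n} → R ≈ˢ S → S ≈ˢ T → R ≈ˢ T
  ≈ˢ-trans {R} {S} {T} R≈S S≈T =
    shared-part {R} {T} (inj₁ refl) (IsPart-resp {S = S} {T} S≈T (IsPart-resp {S = R} {S} R≈S (inj₁ refl)))

  -- `abstract`, as otherwise `does (S ≈ˢ? T)` unfolds and escapes `with`-abstraction.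
  abstract
    _≈ˢ?_ : ∀ (S T : Split n) → Dec (S ≈ˢ T)
    S ≈ˢ? T = (S.A ≟ˢ T.A ×-dec S.B ≟ˢ T.B) ⊎-dec (S.A ≟ˢ T.B ×-dec S.B ≟ˢ T.A)
      where
      module S = Split S
      module T = Split T

  -- The discrete metric on subsets

  differ : Subset n → Subset n → ℕ
  differ P Q = if does (P ≟ˢ Q) then 0 else 1

  differ-≡ : ∀ {P Q} → P ≡ Q → differ P Q ≡ 0
  differ-≡ {P} {Q} P≡Q with P ≟ˢ Q
  ... | yes _   = refl
  ... | no  P≢Q = contradiction P≡Q P≢Q

  differ-≢ : ∀ {P Q} → P ≢ Q → differ P Q ≡ 1
  differ-≢ {P} {Q} P≢Q with P ≟ˢ Q
  ... | yes P≡Q = contradiction P≡Q P≢Q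
  ... | no  _   = refl

  differ≤0 : ∀ {P Q} → differ P Q ≤ 0 → P ≡ Q
  -- In the `no` case the argument would have type `1 ≤ 0`, so only `yes` remains.
  differ≤0 {P} {Q} _ with yes P≡Q ← P ≟ˢ Q = P≡Q

  differ-triangle : ∀ P Q R → differ P R ≤ differ P Q + differ Q R
  differ-triangle P Q R with P ≟ˢ Q | Q ≟ˢ R
  ... | yes p | yes q = ℕ.≤-reflexive (differ-≡ (trans p q))
  ... | yes p | no  q = ℕ.≤-reflexive (differ-≢ (λ r → q (trans (sym p) r)))
  ... | no  p | _ with P ≟ˢ R
  ...   | yes _ = z≤n
  ...   | no  _ = s≤s z≤n

  differ-additive : ∀ {P Q R} → Q ≡ P ⊎ Q ≡ R → differ P R ≡ differ P Q + differ Q R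
  differ-additive {P} {R = R} (inj₁ refl) = cong (_+ differ P R) (sym (differ-≡ {P} refl))
  differ-additive {P} {R = R} (inj₂ refl) =
    trans (sym (ℕ.+-identityʳ _)) (cong (differ P R +_) (sym (differ-≡ {R} refl)))

-- The Buneman graph of a split system given with representatives of its members

module Metric {n : ℕ} (𝒮 : SplitSystem n) (reps : List (Buneman.Member 𝒮))
  (distinct : AllPairs (λ S T → ¬ Buneman._≈ᵐ_ 𝒮 S T) reps)
  (complete : ∀ S → Any (Buneman._≈ᵐ_ 𝒮 S) reps) where

  open Buneman 𝒮

  _≈ᵐ?_ : ∀ S T → Dec (S ≈ᵐ T)
  (S , _) ≈ᵐ? (T , _) = S ≈ˢ? T

  -- Distances only see `reps`, whereas vertices are maps on all members; `complete` bridges the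
  -- two.
  All-reps : ∀ {ℓ} {P : Member → Set ℓ} → (∀ {S T} → S ≈ᵐ T → P T → P S) → All P reps → ∀ S → P S
  All-reps resp ps S = let T , T∈ , S≈T = find (complete S) in resp {S} {T} S≈T (All.lookup ps T∈)

  _≈ᵛ?_ : ∀ u v → Dec (u ≈ᵛ v)
  u ≈ᵛ? v = map′
    (All-reps λ {S} {T} S≈T e → trans (φ-cong u {S} {T} S≈T) (trans e (sym (φ-cong v {S} {T} S≈T))))
    (λ u≈v → All.universal u≈v reps)
    (All.all? (λ S → φ u S ≟ˢ φ v S) reps)

  ≈ᵛ-sym : ∀ {u v} → u ≈ᵛ v → v ≈ᵛ u
  ≈ᵛ-sym u≈v S = sym (u≈v S)

  ≈ᵛ-trans : ∀ {u v w} → u ≈ᵛ v → v ≈ᵛ w → u ≈ᵛ w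
  ≈ᵛ-trans u≈v v≈w S = trans (u≈v S) (v≈w S)

  -- As `reps` contains each unordered split exactly once up to `≈ᵐ`, this counts the splits on
  -- which the two vertices differ.
  dist : Vertex → Vertex → ℕ
  dist u v = sum (map (λ S → differ (φ u S) (φ v S)) reps)

  -- The geodesic interval from `u` to `v`, described split by split.
  Between : Vertex → Vertex → Vertex → Set
  Between u v m = ∀ S → φ m S ≡ φ u S ⊎ φ m S ≡ φ v S

  dist-≈ : ∀ {u v} → u ≈ᵛ v → dist u v ≡ 0
  dist-≈ u≈v = sum-zero (All.universal (λ S → differ-≡ (u≈v S)) reps)

  dist-triangle : ∀ u v w → dist u w ≤ dist u v + dist v w
  dist-triangle u v w = ℕ.≤-trans
    (sum-mono (λ S → differ-triangle (φ u S) (φ v S) (φ w S)) reps)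
    (ℕ.≤-reflexive (sum-+ _ _ reps))

  dist-additive : ∀ {u v m} → Between u v m → dist u v ≡ dist u m + dist m v
  dist-additive btw = trans (sum-cong (λ S → differ-additive (btw S)) reps) (sum-+ _ _ reps)

  -- The triangle inequality holds at every split, so equality in total forces equality at each one.
  -- Where `u` and `v` agree, the term of `u` and `m` then vanishes.
  dist-tight : ∀ {u v m} → dist u m + dist m v ≤ dist u v → ∀ S → φ u S ≡ φ v S → φ m S ≡ φ u S
  dist-tight {u} {v} {m} le = All-reps
    (λ {S} {T} S≈T h e → trans (φ-cong m {S} {T} S≈T) (trans
      (h (trans (sym (φ-cong u {S} {T} S≈T)) (trans e (φ-cong v {S} {T} S≈T))))
      (sym (φ-cong u {S} {T} S≈T))))
    (All.map (λ {S} le′ e → sym (differ≤0 (ℕ.≤-trans (ℕ.m≤m+n _ _) (ℕ.≤-trans le′ (ℕ.≤-reflexive (differ-≡ e))))))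
      (sum-tight (λ S → differ-triangle (φ u S) (φ m S) (φ v S))
        (ℕ.≤-trans (ℕ.≤-reflexive (sum-+ _ _ reps)) le)))

  -- Distinctness of the entries allows only one of them to be equivalent to `S`.
  sum-single : ∀ {S} {f : Member → ℕ} → (∀ {T} → S ≈ᵐ T → f T ≡ 1) → (∀ {T} → ¬ S ≈ᵐ T → f T ≡ 0) →
               ∀ {xs} → AllPairs (λ S T → ¬ S ≈ᵐ T) xs → Any (S ≈ᵐ_) xs → sum (map f xs) ≡ 1
  sum-single {S} one nil {T ∷ _} (T≉ ∷ _) (here S≈T) = cong₂ _+_ (one S≈T)
    (sum-zero (All.map (λ {R} T≉R → nil (λ S≈R →
      T≉R (≈ˢ-trans {R = proj₁ T} {proj₁ S} {proj₁ R} (≈ˢ-sym {S = proj₁ S} {proj₁ T} S≈T) S≈R))) T≉))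
  sum-single {S} one nil {T ∷ _} (T≉ ∷ ps) (there q) with find q
  ... | R , R∈ , S≈R = cong₂ _+_
    (nil (λ S≈T → All.lookup T≉ R∈ (≈ˢ-trans {R = proj₁ T} {proj₁ S} {proj₁ R} (≈ˢ-sym {S = proj₁ S} {proj₁ T} S≈T) S≈R)))
    (sum-single {S} one nil ps q)

  dist-adjacent : ∀ {u v} → Adjacent u v → dist u v ≡ 1
  dist-adjacent {u} {v} (S , uS≢vS , unique) = sum-single {S}
    (λ {T} S≈T → differ-≢ (λ e → uS≢vS (trans (φ-cong u {S} {T} S≈T) (trans e (sym (φ-cong v {S} {T} S≈T))))))
    (λ {T} S≉T → differ-≡ (decidable-stable (φ u T ≟ˢ φ v T) (λ uT≢vT → S≉T (unique uT≢vT))))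
    distinct (complete S)

  -- Lower bounds for the lengths of walks

  dist≤length : ∀ {u v k} → Walk u v k → dist u v ≤ k
  dist≤length {u} {v} (stop u≈v) = ℕ.≤-reflexive (dist-≈ {u} {v} u≈v)
  dist≤length {u} {v} (step {w = w} u~w p) = ℕ.≤-trans (dist-triangle u w v)
    (ℕ.+-mono-≤ (ℕ.≤-reflexive (dist-adjacent {u} {w} u~w)) (dist≤length p))

  -- Induction along the walk: every step before `m` adds at most 1 to the distance to `m`, and once
  -- the walk is at `m`, what remains is bounded by `dist≤length`.
  On⇒dist≤length : ∀ {u v k m} {p : Walk u v k} → m On p → dist u m + dist m v ≤ k
  On⇒dist≤length {u} {v} {m = m} (end {e = u≈v} m≈v) = ℕ.≤-reflexive (cong₂ _+_
    (dist-≈ {u} {m} (≈ᵛ-trans {u} {v} {m} u≈v (≈ᵛ-sym {m} {v} m≈v))) (dist-≈ {m} {v} m≈v))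
  On⇒dist≤length {u} {v} {m = m} (here {e = u~w} {p = p} m≈u) = ℕ.+-mono-≤
    (ℕ.≤-reflexive (dist-≈ {u} {m} (≈ᵛ-sym {m} {u} m≈u)))
    (ℕ.≤-trans (dist-triangle m u v)
      (ℕ.+-mono-≤ (ℕ.≤-reflexive (dist-≈ {m} {u} m≈u)) (dist≤length (step {u} u~w p))))
  On⇒dist≤length {u} {v} {m = m} (there {w = w} {e = u~w} m∈p) = ℕ.≤-trans
    (ℕ.+-monoˡ-≤ _ (ℕ.≤-trans (dist-triangle u w m)
      (ℕ.+-monoˡ-≤ _ (ℕ.≤-reflexive (dist-adjacent {u} {w} u~w)))))
    (s≤s (On⇒dist≤length m∈p))

  -- One step towards another vertex

  module Flip (u v : Vertex) (S : Member) (uS≢vS : φ u S ≢ φ v S)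
    (minimal : ∀ T → φ u T ≢ φ v T → ∣ φ u S ∣ ≤ ∣ φ u T ∣) where

    value : Member → Subset n
    value T = if does (S ≈ᵐ? T) then φ v T else φ u T

    value-≈ : ∀ {T} → S ≈ᵐ T → value T ≡ φ v T
    value-≈ {T} S≈T with S ≈ᵐ? T
    ... | yes _   = refl
    ... | no  S≉T = contradiction S≈T S≉T

    value-≉ : ∀ {T} → ¬ S ≈ᵐ T → value T ≡ φ u T
    value-≉ {T} S≉T with S ≈ᵐ? T
    ... | yes S≈T = contradiction S≈T S≉T
    ... | no  _   = refl

    -- If v(S) and u(T) were disjoint, then u(T) ⊆ u(S), and properly so since T ≉ S.
    meets : ∀ T → ¬ S ≈ᵐ T → Nonempty (φ v S ∩ φ u T)
    meets T S≉T with φ u T ≟ˢ φ v T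
    ... | yes e = subst (λ P → Nonempty (φ v S ∩ P)) (sym e) (B2 v S T S≉T)
    ... | no uT≢vT with nonempty? (φ v S ∩ φ u T)
    ...   | yes ne = ne
    ...   | no empty = contradiction
            (shared-part {S = proj₁ S} {proj₁ T} (B1 u S) (subst (λ P → IsPart P (proj₁ T)) uT≡uS (B1 u T))) S≉T
      where
      uT⊆uS : φ u T ⊆ φ u S
      uT⊆uS {x} x∈uT with third-part (proj₁ S) (B1 u S) (B1 v S) (part-isPart (proj₁ S) x) uS≢vS
      ... | inj₁ e = subst (x ∈_) e (x∈part (proj₁ S) x)
      ... | inj₂ e = contradiction (x , x∈p∩q⁺ (subst (x ∈_) e (x∈part (proj₁ S) x) , x∈uT)) empty
      uS⊆uT : φ u S ⊆ φ u T
      -- A point outside `φ u T` would make the inclusion proper, and `T` would be a differing split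
      -- with a smaller side, against minimality.
      uS⊆uT {x} x∈uS = decidable-stable (x ∈? φ u T) (λ x∉uT →
        ℕ.<⇒≱ (p⊂q⇒∣p∣<∣q∣ (uT⊆uS , x , x∈uS , x∉uT)) (minimal T uT≢vT))
      uT≡uS : φ u T ≡ φ u S
      uT≡uS = ⊆-antisym uT⊆uS uS⊆uT

    value-meets : ∀ {T R} → S ≈ᵐ T → ¬ S ≈ᵐ R → Nonempty (φ v T ∩ φ u R)
    value-meets {T} {R} S≈T S≉R = subst (λ P → Nonempty (P ∩ φ u R)) (φ-cong v {S} {T} S≈T) (meets R S≉R)

    flipped : Vertex
    flipped .φ = value
    flipped .φ-cong {T} {R} T≈R with S ≈ᵐ? T | S ≈ᵐ? R
    ... | yes _   | yes _   = φ-cong v {T} {R} T≈R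
    ... | no _    | no _    = φ-cong u {T} {R} T≈R
    ... | yes S≈T | no S≉R  = contradiction (≈ˢ-trans {R = proj₁ S} {proj₁ T} {proj₁ R} S≈T T≈R) S≉R
    ... | no S≉T  | yes S≈R = contradiction
      (≈ˢ-trans {R = proj₁ S} {proj₁ R} {proj₁ T} S≈R (≈ˢ-sym {S = proj₁ T} {proj₁ R} T≈R)) S≉T
    flipped .B1 T with S ≈ᵐ? T
    ... | yes _ = B1 v T
    ... | no  _ = B1 u T
    flipped .B2 T R T≉R with S ≈ᵐ? T | S ≈ᵐ? R
    ... | yes _   | yes _   = B2 v T R T≉R
    ... | no _    | no _    = B2 u T R T≉R
    ... | yes S≈T | no S≉R  = value-meets {T} {R} S≈T S≉R
    ... | no S≉T  | yes S≈R = subst Nonempty (∩-comm (φ v R) (φ u T)) (value-meets {R} {T} S≈R S≉T)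

    adjacent : Adjacent u flipped
    adjacent = S , (λ e → uS≢vS (trans e (value-≈ {S} (≈ˢ-refl {S = proj₁ S}))))
      , λ {T} uT≢ → decidable-stable (S ≈ᵐ? T) (λ S≉T → uT≢ (sym (value-≉ {T} S≉T)))

    between : Between u v flipped
    between T with S ≈ᵐ? T
    ... | yes _ = inj₂ refl
    ... | no  _ = inj₁ refl

  -- Geodesics and shortest paths

  minimal-difference : ∀ u v {k} → dist u v ≡ suc k →
    ∃ λ S → φ u S ≢ φ v S × (∀ T → φ u T ≢ φ v T → ∣ φ u S ∣ ≤ ∣ φ u T ∣)
  minimal-difference u v d≡ with any? (λ S → ¬? (φ u S ≟ˢ φ v S)) reps
  ... | no none = contradiction
    (trans (sym d≡) (sum-zero (All.map (λ {S} ¬≢ → differ-≡ (decidable-stable (φ u S ≟ˢ φ v S) ¬≢)) (¬Any⇒All¬ reps none))))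
    (λ ())
  ... | yes some with find some
  -- `S₀` is the starting value of `argmin`; since it differs itself, the minimiser is a differing
  -- split even if it is `S₀`.
  ...   | S₀ , _ , uS₀≢vS₀ = argmin size S₀ differing
        , argmin-all size uS₀≢vS₀ (all-filter differ? reps)
        , λ T → All-reps
            (λ {R} {T} R≈T h uR≢vR → subst (_ ≤_) (cong ∣_∣ (sym (φ-cong u {R} {T} R≈T)))
              (h (λ e → uR≢vR (trans (φ-cong u {R} {T} R≈T) (trans e (sym (φ-cong v {R} {T} R≈T)))))))
            (All.tabulate (λ T∈ uT≢vT → All.lookup (f[argmin]≤f[xs] S₀ differing) (∈-filter⁺ differ? T∈ uT≢vT)))
            T
    where
    size : Member → ℕ
    size S = ∣ φ u S ∣
    differ? : ∀ S → Dec (φ u S ≢ φ v S)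
    differ? S = ¬? (φ u S ≟ˢ φ v S)
    differing : List Member
    differing = filter differ? reps

  -- Flipping a minimal differing split gives a neighbour of `u` between `u` and `v`, so the
  -- distance drops by exactly 1. With `dist≤length`, this makes `dist` the graph distance.
  geodesic : ∀ k u v → dist u v ≡ k → Walk u v k
  geodesic zero u v d≡0 = stop (All-reps
    (λ {S} {T} S≈T e → trans (φ-cong u {S} {T} S≈T) (trans e (sym (φ-cong v {S} {T} S≈T))))
    -- A zero sum is tight against the constant function 0, so all its terms vanish.
    (All.map differ≤0 (sum-tight {f = λ _ → 0} (λ _ → z≤n) (ℕ.≤-trans (ℕ.≤-reflexive d≡0) z≤n))))
  geodesic (suc k) u v d≡ with minimal-difference u v d≡
  ... | S , uS≢vS , minimal = step {w = F.flipped} F.adjacent (geodesic k F.flipped v (ℕ.suc-injective (begin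
      suc (dist F.flipped v)             ≡⟨ cong (_+ dist F.flipped v) (dist-adjacent {u} {F.flipped} F.adjacent) ⟨
      dist u F.flipped + dist F.flipped v ≡⟨ dist-additive {u} {v} {F.flipped} F.between ⟨
      dist u v                           ≡⟨ d≡ ⟩
      suc k                              ∎)))
    where
    module F = Flip u v S uS≢vS minimal
    open ≡-Reasoning

  append : ∀ {u m v j k} → Walk u m j → Walk m v k → Σ (Walk u v (j + k)) (m On_)
  append {u} {m} {v} (stop u≈m) (stop m≈v) = stop (≈ᵛ-trans {u} {m} {v} u≈m m≈v) , end m≈v
  -- The vertices `u` and `m` are only equivalent, so the adjacency leaving `m` is transported to
  -- `u`.
  append {u} {m} (stop u≈m) (step (S , mS≢wS , unique) q) =
    step (S , (λ e → mS≢wS (trans (sym (u≈m S)) e)) , (λ {T} uT≢wT → unique (λ e → uT≢wT (trans (u≈m T) e)))) q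
    , here (≈ᵛ-sym {u} {m} u≈m)
  append (step e p) q = let r , m∈r = append p q in step e r , there m∈r

  -- Two geodesics glued at `m` have total length `dist u v` by additivity, and no walk is shorter.
  Between⇒OnShortestPath : ∀ {u v m} → Between u v m → OnShortestPath u v m
  Between⇒OnShortestPath {u} {v} {m} btw =
    let p , m∈p = append (geodesic _ u m refl) (geodesic _ m v refl)
    in _ , p , (λ q → ℕ.≤-trans (ℕ.≤-reflexive (sym (dist-additive {u} {v} {m} btw))) (dist≤length q)) , m∈p

  -- A shortest path is no longer than the geodesic of length `dist u v`, so the triangle inequality
  -- through `m` is tight.
  OnShortestPath⇒agrees : ∀ {u v m} → OnShortestPath u v m → ∀ S → φ u S ≡ φ v S → φ m S ≡ φ u S
  OnShortestPath⇒agrees {u} {v} {m} (_ , p , shortest , m∈p) =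
    dist-tight {u} {v} {m} (ℕ.≤-trans (On⇒dist≤length m∈p) (shortest (geodesic _ u v refl)))

  -- Medians by majority vote

  module Median (u v w : Vertex) where

    -- If `u` and `v` disagree, they take up both parts of the split, and `w` casts the deciding
    -- vote.
    value : Member → Subset n
    value S = if does (φ u S ≟ˢ φ v S) then φ u S else φ w S

    majority : ∀ S → (value S ≡ φ u S × value S ≡ φ v S)
                   ⊎ (value S ≡ φ v S × value S ≡ φ w S)
                   ⊎ (value S ≡ φ u S × value S ≡ φ w S)
    majority S with φ u S ≟ˢ φ v S
    ... | yes e = inj₁ (refl , e)
    ... | no uS≢vS with third-part (proj₁ S) (B1 u S) (B1 v S) (B1 w S) uS≢vS
    ...   | inj₁ e = inj₂ (inj₂ (e , refl))
    ...   | inj₂ e = inj₂ (inj₁ (e , refl))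

    meet : ∀ z {P Q S T} → ¬ S ≈ᵐ T → P ≡ φ z S → Q ≡ φ z T → Nonempty (P ∩ Q)
    meet z {S = S} {T} S≉T refl refl = B2 z S T S≉T

    median : Vertex
    median .φ = value
    median .φ-cong {S} {T} S≈T
      rewrite φ-cong u {S} {T} S≈T | φ-cong v {S} {T} S≈T | φ-cong w {S} {T} S≈T = refl
    median .B1 S with φ u S ≟ˢ φ v S
    ... | yes _ = B1 u S
    ... | no  _ = B1 w S
    -- Two majorities among three voters have a voter in common, and (B2) for that vertex gives the
    -- common point.
    median .B2 S T S≉T with majority S | majority T
    ... | inj₁ (a , _)        | inj₁ (a′ , _)        = meet u {S = S} {T} S≉T a a′
    ... | inj₁ (_ , b)        | inj₂ (inj₁ (b′ , _)) = meet v {S = S} {T} S≉T b b′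
    ... | inj₁ (a , _)        | inj₂ (inj₂ (a′ , _)) = meet u {S = S} {T} S≉T a a′
    ... | inj₂ (inj₁ (b , _)) | inj₁ (_ , b′)        = meet v {S = S} {T} S≉T b b′
    ... | inj₂ (inj₁ (b , _)) | inj₂ (inj₁ (b′ , _)) = meet v {S = S} {T} S≉T b b′
    ... | inj₂ (inj₁ (_ , c)) | inj₂ (inj₂ (_ , c′)) = meet w {S = S} {T} S≉T c c′
    ... | inj₂ (inj₂ (a , _)) | inj₁ (a′ , _)        = meet u {S = S} {T} S≉T a a′
    ... | inj₂ (inj₂ (_ , c)) | inj₂ (inj₁ (_ , c′)) = meet w {S = S} {T} S≉T c c′
    ... | inj₂ (inj₂ (a , _)) | inj₂ (inj₂ (a′ , _)) = meet u {S = S} {T} S≉T a a′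

    between-uv : Between u v median
    between-uv S with majority S
    ... | inj₁ (a , _)        = inj₁ a
    ... | inj₂ (inj₁ (b , _)) = inj₂ b
    ... | inj₂ (inj₂ (a , _)) = inj₁ a

    between-vw : Between v w median
    between-vw S with majority S
    ... | inj₁ (_ , b)        = inj₁ b
    ... | inj₂ (inj₁ (b , _)) = inj₁ b
    ... | inj₂ (inj₂ (_ , c)) = inj₂ c

    between-uw : Between u w median
    between-uw S with majority S
    ... | inj₁ (a , _)        = inj₁ a
    ... | inj₂ (inj₁ (_ , c)) = inj₂ c
    ... | inj₂ (inj₂ (a , _)) = inj₁ a

    -- At each split two of the three vertices agree on the majority value, and a shortest path
    -- between these two cannot leave it.
    unique : ∀ {m} → IsMedian u v w m → m ≈ᵛ median
    unique {m} (uv , vw , uw) S with majority S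
    ... | inj₁ (a , b) = trans (OnShortestPath⇒agrees {u} {v} {m} uv S (trans (sym a) b)) (sym a)
    ... | inj₂ (inj₁ (b , c)) = trans (OnShortestPath⇒agrees {v} {w} {m} vw S (trans (sym b) c)) (sym b)
    ... | inj₂ (inj₂ (a , c)) = trans (OnShortestPath⇒agrees {u} {w} {m} uw S (trans (sym a) c)) (sym a)

-- Three-element subsets

x∉p-x : ∀ {n} (p : Subset n) x → x ∉ p - x
x∉p-x (inside  ∷ p) zero ()
x∉p-x (outside ∷ p) zero ()
x∉p-x (s ∷ p) (suc x) (there x∈) = x∉p-x p x x∈

∣p∣≡1+∣p-x∣ : ∀ {n} {p : Subset n} {x} → x ∈ p → ∣ p ∣ ≡ suc ∣ p - x ∣
∣p∣≡1+∣p-x∣ {p = inside ∷ p} here = cong (λ q → suc ∣ q ∣) (sym (p─⊥≡p p))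
∣p∣≡1+∣p-x∣ {p = inside  ∷ p} (there x∈p) = cong suc (∣p∣≡1+∣p-x∣ x∈p)
∣p∣≡1+∣p-x∣ {p = outside ∷ p} (there x∈p) = ∣p∣≡1+∣p-x∣ x∈p

remove-one : ∀ {n k} {p : Subset n} → ∣ p ∣ ≡ suc k → ∃ λ x → x ∈ p × ∣ p - x ∣ ≡ k
remove-one {n} {p = p} ∣p∣≡ with nonempty? p
... | yes (x , x∈p) = x , x∈p , ℕ.suc-injective (trans (sym (∣p∣≡1+∣p-x∣ x∈p)) ∣p∣≡)
... | no  empty     = contradiction (trans (sym (∣⊥∣≡0 n)) (trans (sym (cong ∣_∣ (Empty-unique empty))) ∣p∣≡)) λ ()

record ThreeElements {n} (Y : Subset n) : Set where
  field
    x y z       : Fin n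
    x∈          : x ∈ Y
    y∈          : y ∈ Y
    z∈          : z ∈ Y
    x≢y         : x ≢ y
    y≢z         : y ≢ z
    x≢z         : x ≢ z
    exhaustive  : ∀ {a} → a ∈ Y → a ≡ x ⊎ a ≡ y ⊎ a ≡ z

threeElements : ∀ {n} {Y : Subset n} → ∣ Y ∣ ≡ 3 → ThreeElements Y
threeElements {n} {Y} ∣Y∣≡3 with remove-one {p = Y} ∣Y∣≡3
... | x , x∈ , e₂ with remove-one {p = Y - x} e₂
... | y , y∈ , e₁ with remove-one {p = Y - x - y} e₁
... | z , z∈ , e₀ = record
  { x = x ; y = y ; z = z ; x∈ = x∈ ; y∈ = p─q⊆p Y ⁅ x ⁆ y∈ ; z∈ = p─q⊆p Y ⁅ x ⁆ z∈Y-x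
  ; x≢y = λ e → x∉p-x Y x (subst (_∈ Y - x) (sym e) y∈)
  ; y≢z = λ e → x∉p-x (Y - x) y (subst (_∈ Y - x - y) (sym e) z∈)
  ; x≢z = λ e → x∉p-x Y x (subst (_∈ Y - x) (sym e) z∈Y-x)
  ; exhaustive = exhaust
  }
  where
  z∈Y-x : z ∈ Y - x
  z∈Y-x = p─q⊆p (Y - x) ⁅ y ⁆ z∈
  exhaust : ∀ {a} → a ∈ Y → a ≡ x ⊎ a ≡ y ⊎ a ≡ z
  exhaust {a} a∈ with a Fin.≟ x | a Fin.≟ y | a Fin.≟ z
  ... | yes a≡x | _ | _ = inj₁ a≡x
  ... | no _ | yes a≡y | _ = inj₂ (inj₁ a≡y)
  ... | no _ | no _ | yes a≡z = inj₂ (inj₂ a≡z)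
  -- A fourth element would survive all three removals, but the remaining set has size 0.
  ... | no a≢x | no a≢y | no a≢z = contradiction
    (trans (sym e₀) (∣p∣≡1+∣p-x∣ (x∈p∧x≢y⇒x∈p-y (x∈p∧x≢y⇒x∈p-y (x∈p∧x≢y⇒x∈p-y a∈ a≢x) a≢y) a≢z))) λ ()

-- Supplies the majority of `Y` that avoids `a`. In `medianOf-⊆` it is applied to a point that may
-- or may not lie in the set.
two-others : ∀ {n} {Y : Subset n} → ∣ Y ∣ ≡ 3 → ∀ a →
  ∃ λ b → ∃ λ c → b ∈ Y × c ∈ Y × b ≢ c × b ≢ a × c ≢ a
two-others {Y = Y} ∣Y∣≡3 a = go
  where
  open ThreeElements (threeElements {Y = Y} ∣Y∣≡3)
  go : ∃ λ b → ∃ λ c → b ∈ Y × c ∈ Y × b ≢ c × b ≢ a × c ≢ a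
  go with x Fin.≟ a | y Fin.≟ a
  ... | yes refl | _        = y , z , y∈ , z∈ , y≢z , (λ e → x≢y (sym e)) , (λ e → x≢z (sym e))
  ... | no _     | yes refl = x , z , x∈ , z∈ , x≢z , x≢y , (λ e → y≢z (sym e))
  ... | no x≢a   | no y≢a   = x , y , x∈ , y∈ , x≢y , x≢a , y≢a

someTriple : ∀ {n} → 3 ≤ n → Triple n
someTriple {suc (suc (suc n))} (s≤s (s≤s (s≤s z≤n))) =
  inside ∷ inside ∷ inside ∷ Subset.⊥ , cong (3 +_) (∣⊥∣≡0 n)

-- The system of all splits

sides : List Subset.Side
sides = inside ∷ outside ∷ []

subsets : ∀ n → List (Subset n)
subsets zero    = [] ∷ []
subsets (suc n) = cartesianProductWith _∷_ sides (subsets n)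

∈-subsets : ∀ {n} (p : Subset n) → p ∈ₗ subsets n
∈-subsets []            = here refl
∈-subsets (inside  ∷ p) = ∈-cartesianProductWith⁺ _∷_ {xs = sides} (here refl) (∈-subsets p)
∈-subsets (outside ∷ p) = ∈-cartesianProductWith⁺ _∷_ {xs = sides} (there (here refl)) (∈-subsets p)

allSplits : ∀ n → SplitSystem n
allSplits n = record { member = U ; resp = λ _ _ → _ ; trivial = λ _ _ → _ }

module _ {n : ℕ} where

  open Buneman (allSplits n)

  member : Split n → Member
  member S = S , _

  splitsWithPart : Subset n → List Member
  splitsWithPart A with nonempty? A | nonempty? (∁ A)
  ... | yes neA | yes ne∁A = member (splitOf A neA ne∁A) ∷ []
  ... | _       | _        = []

  splitsWithPart-complete : ∀ S → Any (S ≈ᵐ_) (splitsWithPart (Split.A (proj₁ S)))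
  splitsWithPart-complete (S , _) with nonempty? (Split.A S) | nonempty? (∁ (Split.A S))
  ... | yes _ | yes _ = here (inj₁ (refl , B≡∁A S))
  ... | yes _ | no ¬ne = contradiction (subst Nonempty (B≡∁A S) (Split.nonemptyB S)) ¬ne
  ... | no ¬ne | _ = contradiction (Split.nonemptyA S) ¬ne

  memberDecSetoid : DecSetoid 0ℓ 0ℓ
  memberDecSetoid = record
    { Carrier = Member
    ; _≈_ = _≈ᵐ_
    ; isDecEquivalence = record
      { isEquivalence = record
        { refl  = λ {S} → ≈ˢ-refl {S = proj₁ S}
        ; sym   = λ {S} {T} → ≈ˢ-sym {S = proj₁ S} {proj₁ T}
        ; trans = λ {R} {S} {T} → ≈ˢ-trans {R = proj₁ R} {proj₁ S} {proj₁ T}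
        }
      ; _≟_ = λ S T → proj₁ S ≈ˢ? proj₁ T
      }
    }

  open DecSetoid memberDecSetoid using () renaming (_≟_ to _≟ᵐ_)

  splits : List Member
  splits = concatMap splitsWithPart (subsets n)

  splits-complete : IsEnumeration (DecSetoid.setoid memberDecSetoid) splits
  splits-complete S = concatMap⁺ splitsWithPart
    (Any.map (λ { refl → splitsWithPart-complete S }) (∈-subsets (Split.A (proj₁ S))))

  -- `splits` lists every unordered split twice, once for each side; deduplication leaves one
  -- representative.
  open Metric (allSplits n) (deduplicate _≟ᵐ_ splits)
    (deduplicate-! memberDecSetoid splits)
    (deduplicate⁺ memberDecSetoid splits-complete)

  -- Medians of triples of leaves

  module _ (Y : Triple n) where

    open ThreeElements (threeElements {Y = proj₁ Y} (proj₂ Y))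
    open Median (leaf x) (leaf y) (leaf z)

    medianOf : Vertex
    medianOf = median

    -- `medianOf` depends on one enumeration of `Y`, while `IsMedianOfTriple` ranges over all
    -- orderings; this removes the order.
    medianOf-between : ∀ {a b} → a ∈ proj₁ Y → b ∈ proj₁ Y → a ≢ b → Between (leaf a) (leaf b) medianOf
    medianOf-between a∈ b∈ a≢b S with exhaustive a∈ | exhaustive b∈
    ... | inj₁ refl        | inj₁ refl        = contradiction refl a≢b
    ... | inj₁ refl        | inj₂ (inj₁ refl) = between-uv S
    ... | inj₁ refl        | inj₂ (inj₂ refl) = between-uw S
    ... | inj₂ (inj₁ refl) | inj₁ refl        = swap (between-uv S)
    ... | inj₂ (inj₁ refl) | inj₂ (inj₁ refl) = contradiction refl a≢b
    ... | inj₂ (inj₁ refl) | inj₂ (inj₂ refl) = between-vw S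
    ... | inj₂ (inj₂ refl) | inj₁ refl        = swap (between-uw S)
    ... | inj₂ (inj₂ refl) | inj₂ (inj₁ refl) = swap (between-vw S)
    ... | inj₂ (inj₂ refl) | inj₂ (inj₂ refl) = contradiction refl a≢b

    medianOf-isMedian : IsMedianOfTriple Y medianOf
    medianOf-isMedian a b c a∈ b∈ c∈ a≢b b≢c a≢c =
        onPath a∈ b∈ a≢b , onPath b∈ c∈ b≢c , onPath a∈ c∈ a≢c
      where
      onPath : ∀ {a b} → a ∈ proj₁ Y → b ∈ proj₁ Y → a ≢ b → OnShortestPath (leaf a) (leaf b) medianOf
      onPath {a} {b} a∈ b∈ a≢b = Between⇒OnShortestPath {leaf a} {leaf b} {medianOf} (medianOf-between a∈ b∈ a≢b)

    medianOf-unique : ∀ v → IsMedianOfTriple Y v → v ≈ᵛ medianOf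
    medianOf-unique v isMedian = unique {v} (isMedian x y z x∈ y∈ z∈ x≢y y≢z x≢z)

    -- Betweenness leaves only the parts of `a` and of `b`, and both are `P`.
    medianOf-part : ∀ S {P a b} → IsPart P (proj₁ S) → a ∈ proj₁ Y → b ∈ proj₁ Y → a ≢ b →
                    a ∈ P → b ∈ P → φ medianOf S ≡ P
    medianOf-part S@(S′ , _) {a = a} {b} isPart a∈ b∈ a≢b a∈P b∈P with medianOf-between a∈ b∈ a≢b S
    ... | inj₁ e = trans e (sym (part-unique S′ a isPart a∈P))
    ... | inj₂ e = trans e (sym (part-unique S′ b isPart b∈P))

    -- On the trivial split of `a`, two elements of `Y` other than `a` outvote it, whereas the leaf
    -- of `a` takes the singleton.
    medianOf-interior : ∀ a → ¬ medianOf ≈ᵛ leaf a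
    medianOf-interior a m≈a with two-others {Y = proj₁ Y} (proj₂ Y) a
    ... | b , c , b∈ , c∈ , b≢c , b≢a , c≢a = A≢B S (begin
        ⁅ a ⁆              ≡⟨ part-unique S a (inj₁ refl) (x∈⁅x⁆ a) ⟩
        part S a           ≡⟨ m≈a (member S) ⟨
        φ medianOf (member S) ≡⟨ medianOf-part (member S) (inj₂ refl) b∈ c∈ b≢c (∈∁ b≢a) (∈∁ c≢a) ⟩
        ∁ ⁅ a ⁆            ∎)
      where
      open ≡-Reasoning
      ∈∁ : ∀ {d} → d ≢ a → d ∈ ∁ ⁅ a ⁆
      ∈∁ d≢a = x∉p⇒x∈∁p (x≢y⇒x∉⁅y⁆ d≢a)
      S : Split n
      S = splitOf ⁅ a ⁆ (a , x∈⁅x⁆ a) (b , ∈∁ b≢a)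

    interiorMedian : Interior
    interiorMedian = medianOf , medianOf-interior

  -- The median determines the triple

  medianOf-⊆ : ∀ (Y Z : Triple n) → medianOf Y ≈ᵛ medianOf Z → proj₁ Y ⊆ proj₁ Z
  medianOf-⊆ 𝒴@(Y , ∣Y∣≡3) 𝒵@(Z , ∣Z∣≡3) mY≈mZ {x} x∈Y = decidable-stable (x ∈? Z) separated
    where
    open ≡-Reasoning
    separated : ¬ x ∉ Z
    separated x∉Z with two-others {Y = Y} ∣Y∣≡3 x
    -- As `x` is not in `Z`, the side `A` meets `Z` at most in `a`; the two elements of `Z` other
    -- than `a` form a majority on the opposite side.
    ... | a , _ , a∈Y , _ , _ , a≢x , _ with two-others {Y = Z} ∣Z∣≡3 a
    ... | c , d , c∈Z , d∈Z , c≢d , c≢a , d≢a = A≢B S (begin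
        A                       ≡⟨ medianOf-part 𝒴 (member S) (inj₁ refl) x∈Y a∈Y (λ e → a≢x (sym e)) x∈A a∈A ⟨
        φ (medianOf 𝒴) (member S) ≡⟨ mY≈mZ (member S) ⟩
        φ (medianOf 𝒵) (member S) ≡⟨ medianOf-part 𝒵 (member S) (inj₂ refl) c∈Z d∈Z c≢d (∈∁A c∈Z c≢a) (∈∁A d∈Z d≢a) ⟩
        ∁ A                     ∎)
      where
      A : Subset n
      A = ⁅ x ⁆ ∪ ⁅ a ⁆
      x∈A : x ∈ A
      x∈A = x∈p∪q⁺ (inj₁ (x∈⁅x⁆ x))
      a∈A : a ∈ A
      a∈A = x∈p∪q⁺ (inj₂ (x∈⁅x⁆ a))
      ∈∁A : ∀ {e} → e ∈ Z → e ≢ a → e ∈ ∁ A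
      ∈∁A e∈Z e≢a = x∉p⇒x∈∁p (λ e∈A → [ (λ e∈x → x∉Z (subst (_∈ Z) (x∈⁅y⁆⇒x≡y x e∈x) e∈Z))
                                      , (λ e∈a → e≢a (x∈⁅y⁆⇒x≡y a e∈a)) ]′ (x∈p∪q⁻ ⁅ x ⁆ ⁅ a ⁆ e∈A))
      S : Split n
      S = splitOf A (x , x∈A) (c , ∈∁A c∈Z c≢a)

  medianOf-injective : ∀ {Y Z : Triple n} → medianOf Y ≈ᵛ medianOf Z → Y ≡ Z
  medianOf-injective {𝒴@(Y , p)} {𝒵@(Z , q)} mY≈mZ
    with refl ← ⊆-antisym (medianOf-⊆ 𝒴 𝒵 mY≈mZ) (medianOf-⊆ 𝒵 𝒴 (≈ᵛ-sym {medianOf 𝒴} {medianOf 𝒵} mY≈mZ))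
    -- A triple carries its size proof, which is unique because equality on `ℕ` is irrelevant.
    = cong (Y ,_) (ℕ.≡-irrelevant p q)

  IsMedianVertex : Vertex → Set
  IsMedianVertex v = ∃ λ (Y : Triple n) → v ≈ᵛ medianOf Y

  -- `label` is defined by cases on being a median; this is decidable by a search through the
  -- finitely many subsets.
  isMedianVertex? : ∀ v → Dec (IsMedianVertex v)
  isMedianVertex? v = map′ (λ (Y , p , e) → (Y , p) , e) (λ ((Y , p) , e) → Y , p , e) (anySubset? medianOf?)
    where
    medianOf? : ∀ Y → Dec (∃ λ p → v ≈ᵛ medianOf (Y , p))
    medianOf? Y with ∣ Y ∣ ℕ.≟ 3
    ... | no ∣Y∣≢3 = no (λ (p , _) → ∣Y∣≢3 p)
    ... | yes p = map′ (p ,_) (λ (q , e) → subst (λ r → v ≈ᵛ medianOf (Y , r)) (ℕ.≡-irrelevant q p) e)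
                    (v ≈ᵛ? medianOf (Y , p))

  module _ {ℓ} {M : Set ℓ} (3≤n : 3 ≤ n) (δ : Triple n → M) where

    label : Vertex → M
    label v with isMedianVertex? v
    ... | yes (Y , _) = δ Y
    -- Default value away from the medians; here `3 ≤ n` provides a triple and thereby an element of
    -- `M`.
    ... | no _        = δ (someTriple 3≤n)

    -- The search may return a triple `Z` other than the given `Y`; injectivity identifies them.
    label-median : ∀ v Y → v ≈ᵛ medianOf Y → label v ≡ δ Y
    label-median v Y v≈Y with isMedianVertex? v
    ... | yes (Z , v≈Z) = cong δ (medianOf-injective
          (≈ᵛ-trans {medianOf Z} {v} {medianOf Y} (≈ᵛ-sym {v} {medianOf Z} v≈Z) v≈Y))
    ... | no ¬median    = contradiction (Y , v≈Y) ¬median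

    -- The searches at `u` and `v` run independently, so their results are compared through
    -- `label-median`.
    label-cong : ∀ u v → u ≈ᵛ v → label u ≡ label v
    label-cong u v u≈v with isMedianVertex? u
    ... | yes (Y , u≈Y) = sym (label-median v Y
          (≈ᵛ-trans {v} {u} {medianOf Y} (≈ᵛ-sym {u} {v} u≈v) u≈Y))
    ... | no ¬median with isMedianVertex? v
    ...   | yes (Y , v≈Y) = contradiction (Y , ≈ᵛ-trans {u} {v} {medianOf Y} u≈v v≈Y) ¬median
    ...   | no _          = refl

    labelling : Labelling M
    labelling = record { to = λ (v , _) → label v ; cong = λ {(u , _)} {(v , _)} → label-cong u v }

mainTheorem6 : ∀ {ℓ : Level} (n : ℕ) → 3 ≤ n → (M : Set ℓ) (δ : Triple n → M) →
    Σ (SplitSystem n) λ 𝒮 → Σ (Buneman.Labelling 𝒮 M) λ l →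
    ∀ (Y : Triple n) → Σ (Buneman.Interior 𝒮) λ φY →
    Buneman.IsMedianOfTriple 𝒮 Y (proj₁ φY)
    × (∀ v → Buneman.IsMedianOfTriple 𝒮 Y v → Buneman._≈ᵛ_ 𝒮 v (proj₁ φY))
    × δ Y ≡ Func.to l φY
mainTheorem6 n 3≤n M δ = allSplits n , labelling 3≤n δ , λ Y →
  interiorMedian Y , medianOf-isMedian Y , medianOf-unique Y
  , sym (label-median 3≤n δ (medianOf Y) Y (λ _ → refl))
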